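{- For every integer $n\ge 0$, $$C_{n+1}^2=\sum_{k=0}^{n}\frac{(2k+1)(2k+3)(8nk+2n+10k+4)}{(2n+1)(2n+2)(2n+3)(2n+4)(2n+5)}\binom{2n+2}{n-k}\binom{2n+5}{n-k+2},$$ $$C_{n}C_{n+1}=\sum_{k=0}^{n}\frac{(2k+1)(2k+2)(2k+3)}{(2n+1)(2n+2)(2n+3)^2}\binom{2n+3}{n-k}\binom{2n+3}{n-k+1},$$ $$C_{n}C_{n+2}=\sum_{k=0}^{n}\frac{(2k+1)(2k+3)(8nk+14n+10k+16)}{(2n+1)(2n+2)(2n+3)(2n+4)(2n+5)}\binom{2n+2}{n-k}\binom{2n+5}{n-k+1}.$$
   Context: $C_n=\frac{1}{n+1}\binom{2n}{n}$ is the $n$-th Catalan number. -}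

module Defs where

open import Data.Fin using (toℕ)
open import Data.Integer using (+_)
open import Data.Nat as ℕ using (ℕ; suc)
open import Data.Nat.Combinatorics using (_C_)
open import Data.Rational using (ℚ; _/_; _*_)
open import Data.Rational.Properties using (+-0-monoid)
open import Algebra.Properties.Monoid.Sum +-0-monoid using (sum)

fromℕ : ℕ → ℚ
fromℕ m = + m / 1

catalan : ℕ → ℚ
catalan n = (+ 1 / suc n) * fromℕ ((2 ℕ.* n) C n)

-- The upper bound is inclusive: Fin (suc n) enumerates 0, …, n.
∑≤ : (n : ℕ) → (ℕ → ℚ) → ℚ
∑≤ n f = sum {suc n} (λ i → f (toℕ i))

infixl 5 ∑≤
syntax ∑≤ n (λ k → e) = ∑[ k ≤ n ] e

{-# OPTIONS --safe #-}
-- Each sum telescopes: its k-th summand is T k − T (k + 1), where T k is, up to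
-- constants, a quadratic polynomial x k times C(M, s + k) C(N, t + k), and
-- T (n + 1) vanishes because the lower index s + n + 1 exceeds M = s + n.
-- Hence the sum is T 0, a product of two nearly central binomial coefficients.

module Submission where

open import Defs
open import Data.Integer as ℤ using (+_)
open import Data.Integer.Properties as ℤₚ using ()
open import Data.Nat using (ℕ; zero; suc; _+_; _*_; _^_; _∸_; NonZero)
open import Data.Nat.Combinatorics
  using (_C_; nC1≡n; k>n⇒nCk≡0; nCk≡nC[n∸k]; nCk+nC[k+1]≡[n+1]C[k+1])
open import Data.Nat.Properties as ℕₚ
  using (+-suc; +-comm; +-identityʳ; *-identityˡ; *-cancelˡ-≡; m*n≢0; m≤m+n; m+n∸m≡n;
         suc-injective; n<1+n)
open import Data.Nat.Tactic.RingSolver using (solve-∀)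
open import Data.Product using (_×_; _,_)
open import Data.Rational as ℚ using (_/_)
open import Data.Rational.Properties
  using (toℚᵘ-injective; toℚᵘ-homo-+; toℚᵘ-homo-*; toℚᵘ-fromℚᵘ; fromℚᵘ-cong; 0/n≡0)
open import Data.Rational.Unnormalised using (mkℚᵘ; *≡*)
open import Data.Rational.Unnormalised.Properties as ℚᵘₚ using (≃-trans; ≃-sym)
open import Relation.Binary.PropositionalEquality
  using (_≡_; refl; sym; trans; cong; cong₂; module ≡-Reasoning)

open ≡-Reasoning

-- Ratios of neighbouring binomial coefficients.

C-sym : ∀ {n} a b → a + b ≡ n → n C a ≡ n C b
C-sym a b refl = trans (nCk≡nC[n∸k] (m≤m+n a b)) (cong ((a + b) C_) (m+n∸m≡n a b))

-- Induction along Pascal's rule: the relations at `u` and `suc u` in row `n` add up to the one at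
-- `suc u` in row `suc n`. Taking `a` with `u + a ≡ n` in place of a difference avoids truncated
-- subtraction.
C-ratio : ∀ n u a → u + a ≡ n → (n C suc u) * suc u ≡ (n C u) * a
C-ratio n zero .n refl = trans (ℕₚ.*-identityʳ _) (trans (nC1≡n n) (sym (*-identityˡ n)))
-- Here `n` is `suc u`, so both sides vanish: the lower index on the left exceeds `n`.
C-ratio n (suc u) zero eq rewrite trans (sym eq) (+-identityʳ (suc u)) =
  trans (cong (_* suc (suc u)) (k>n⇒nCk≡0 (n<1+n (suc u)))) (sym (ℕₚ.*-zeroʳ (suc u C suc u)))
C-ratio (suc n) (suc u) (suc a) eq = begin
  (suc n C suc (suc u)) * suc (suc u)
    ≡⟨ cong (_* suc (suc u)) (nCk+nC[k+1]≡[n+1]C[k+1] n (suc u)) ⟨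
  (n C suc u + n C suc (suc u)) * suc (suc u)
    ≡⟨ combine (n C u) (n C suc u) (n C suc (suc u))
         (C-ratio n u (suc a) n≡) (C-ratio n (suc u) a (trans (sym (+-suc u a)) n≡)) ⟩
  (n C u + n C suc u) * suc a
    ≡⟨ cong (_* suc a) (nCk+nC[k+1]≡[n+1]C[k+1] n u) ⟩
  (suc n C suc u) * suc a ∎
  where
  n≡ : u + suc a ≡ n
  n≡ = suc-injective eq
  expand : ∀ u Y Z → (Y + Z) * suc (suc u) ≡ Y * suc u + Y + Z * suc (suc u)
  expand = solve-∀
  collect : ∀ a X Y → X * suc a + Y + Y * a ≡ (X + Y) * suc a
  collect = solve-∀
  combine : ∀ X Y Z → Y * suc u ≡ X * suc a → Z * suc (suc u) ≡ Y * a →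
            (Y + Z) * suc (suc u) ≡ (X + Y) * suc a
  combine X Y Z e f =
    trans (expand u Y Z) (trans (cong₂ _+_ (cong (_+ Y) e) f) (collect a X Y))

-- Pascal's rule leaves two neighbouring entries of row `n`; `C-ratio` turns the second into a
-- multiple of the first, and the factors add up to `suc u + a`, which is `suc n`.
C-absorb : ∀ n u a → u + a ≡ n → (suc n C suc u) * suc u ≡ (n C u) * suc n
C-absorb n u a eq = begin
  (suc n C suc u) * suc u
    ≡⟨ cong (_* suc u) (nCk+nC[k+1]≡[n+1]C[k+1] n u) ⟨
  (n C u + n C suc u) * suc u
    ≡⟨ ℕₚ.*-distribʳ-+ (suc u) (n C u) (n C suc u) ⟩
  (n C u) * suc u + (n C suc u) * suc u
    ≡⟨ cong (_+_ ((n C u) * suc u)) (C-ratio n u a eq) ⟩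
  (n C u) * suc u + (n C u) * a
    ≡⟨ ℕₚ.*-distribˡ-+ (n C u) (suc u) a ⟨
  (n C u) * suc (u + a)
    ≡⟨ cong (λ z → (n C u) * suc z) eq ⟩
  (n C u) * suc n ∎

-- Multiplying through by suc u * suc v turns every binomial coefficient into a
-- multiple of M C u or N C v, which leaves the polynomial identity assumed.
C-telescope : ∀ {M N u v a b p x x′} → u + a ≡ M → v + b ≡ N →
  p + x′ * (a * b) ≡ x * (suc u * suc v) →
  p * (suc M C suc u) * (suc N C suc v) + suc M * suc N * x′ * (M C suc u) * (N C suc v)
    ≡ suc M * suc N * x * (M C u) * (N C v)
C-telescope {M} {N} {u} {v} {a} {b} {p} {x} {x′} eqM eqN eq =
  *-cancelˡ-≡ _ _ (suc u * suc v) (begin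
    suc u * suc v * (p * (suc M C suc u) * (suc N C suc v)
      + suc M * suc N * x′ * (M C suc u) * (N C suc v))
      ≡⟨ regroup (suc u) (suc v) p x′ (suc M) (suc N) _ _ _ _ ⟩
    p * ((suc M C suc u) * suc u) * ((suc N C suc v) * suc v)
      + suc M * suc N * x′ * ((M C suc u) * suc u) * ((N C suc v) * suc v)
      ≡⟨ cong₂ _+_
           (cong₂ (λ y z → p * y * z) (C-absorb M u a eqM) (C-absorb N v b eqN))
           (cong₂ (λ y z → suc M * suc N * x′ * y * z) (C-ratio M u a eqM) (C-ratio N v b eqN)) ⟩
    p * ((M C u) * suc M) * ((N C v) * suc N)
      + suc M * suc N * x′ * ((M C u) * a) * ((N C v) * b)
      ≡⟨ factor p x′ a b (suc M) (suc N) (M C u) (N C v) ⟩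
    (p + x′ * (a * b)) * (suc M * suc N * (M C u) * (N C v))
      ≡⟨ cong (_* (suc M * suc N * (M C u) * (N C v))) eq ⟩
    x * (suc u * suc v) * (suc M * suc N * (M C u) * (N C v))
      ≡⟨ finish x (suc u) (suc v) (suc M) (suc N) (M C u) (N C v) ⟩
    suc u * suc v * (suc M * suc N * x * (M C u) * (N C v)) ∎)
  where
  regroup : ∀ U V p x′ m n P Q P′ Q′ →
    U * V * (p * P * Q + m * n * x′ * P′ * Q′)
      ≡ p * (P * U) * (Q * V) + m * n * x′ * (P′ * U) * (Q′ * V)
  regroup = solve-∀
  factor : ∀ p x′ a b m n P Q →
    p * (P * m) * (Q * n) + m * n * x′ * (P * a) * (Q * b)
      ≡ (p + x′ * (a * b)) * (m * n * P * Q)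
  factor = solve-∀
  finish : ∀ x U V m n P Q → x * (U * V) * (m * n * P * Q) ≡ U * V * (m * n * x * P * Q)
  finish = solve-∀

-- Fractions with natural numerators and denominators.

-- `_/_` reduces to lowest terms and is stuck on variables. The equation is therefore proved for
-- unnormalised fractions, where it is a cross-multiplication, and carried over.
/-cross : ∀ a d b e .{{_ : NonZero d}} .{{_ : NonZero e}} → a * e ≡ b * d → + a / d ≡ + b / e
/-cross a (suc d) b (suc e) eq = fromℚᵘ-cong {mkℚᵘ (+ a) d} {mkℚᵘ (+ b) e}
  (*≡* (trans (sym (ℤₚ.pos-* a (suc e))) (trans (cong +_ eq) (ℤₚ.pos-* b (suc d)))))

/-+-/ : ∀ a b d .{{_ : NonZero d}} → (+ a / d) ℚ.+ (+ b / d) ≡ + (a + b) / d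
/-+-/ a b (suc d) = toℚᵘ-injective
  (≃-trans (toℚᵘ-homo-+ (+ a / suc d) (+ b / suc d))
  (≃-trans (ℚᵘₚ.+-cong (toℚᵘ-fromℚᵘ (mkℚᵘ (+ a) d)) (toℚᵘ-fromℚᵘ (mkℚᵘ (+ b) d)))
  (≃-trans (*≡* same) (≃-sym (toℚᵘ-fromℚᵘ (mkℚᵘ (+ (a + b)) d))))))
  where
  distrib : ∀ a b D → (a * D + b * D) * D ≡ (a + b) * (D * D)
  distrib = solve-∀
  same : (+ a ℤ.* + suc d ℤ.+ + b ℤ.* + suc d) ℤ.* + suc d ≡ + (a + b) ℤ.* + (suc d * suc d)
  -- Integer products are pulled back to products in ℕ, leaving an identity for the semiring solver.
  same rewrite sym (ℤₚ.pos-* a (suc d)) | sym (ℤₚ.pos-* b (suc d))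
             | sym (ℤₚ.pos-* (a * suc d + b * suc d) (suc d))
             | sym (ℤₚ.pos-* (a + b) (suc d * suc d)) = cong +_ (distrib a b (suc d))

/-*-/ : ∀ a b c d .{{_ : NonZero b}} .{{_ : NonZero d}} →
        (+ a / b) ℚ.* (+ c / d) ≡ (+ (a * c) / (b * d)) {{m*n≢0 b d}}
/-*-/ a (suc b) c (suc d) = toℚᵘ-injective
  (≃-trans (toℚᵘ-homo-* (+ a / suc b) (+ c / suc d))
  (≃-trans (ℚᵘₚ.*-cong (toℚᵘ-fromℚᵘ (mkℚᵘ (+ a) b)) (toℚᵘ-fromℚᵘ (mkℚᵘ (+ c) d)))
  (≃-trans (ℚᵘₚ.≃-reflexive (cong (λ z → mkℚᵘ z (d + b * suc d)) (sym (ℤₚ.pos-* a c))))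
           (≃-sym (toℚᵘ-fromℚᵘ (mkℚᵘ (+ (a * c)) (d + b * suc d)))))))

/-*-fromℕ : ∀ a d b .{{_ : NonZero d}} → (+ a / d) ℚ.* fromℕ b ≡ + (a * b) / d
/-*-fromℕ a d b = trans (/-*-/ a d b 1)
  (/-cross (a * b) (d * 1) (a * b) d {{m*n≢0 d 1}} (cong (a * b *_) (sym (ℕₚ.*-identityʳ d))))

-- Telescoping of the sums.

-- Induction on `n` with `f` and `T` shifted by one: the tail collapses to `T 1`, which `f 0`
-- completes to `T 0`. The relation is additive so that all numerators can stay in ℕ, and `m` stands
-- for `n - k`, which encodes `k ≤ n`.
∑-telescope : ∀ n (f T : ℕ → ℚ.ℚ) → (∀ k m → k + m ≡ n → f k ℚ.+ T (suc k) ≡ T k) →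
              T (suc n) ≡ ℚ.0ℚ → ∑≤ n f ≡ T 0
∑-telescope zero f T step end = trans (cong (f 0 ℚ.+_) (sym end)) (step 0 0 refl)
∑-telescope (suc n) f T step end = trans
  (cong (f 0 ℚ.+_) (∑-telescope n (λ k → f (suc k)) (λ k → T (suc k))
    (λ k m eq → step (suc k) m (cong suc eq)) end))
  (step 0 (suc n) refl)

-- The certificate of the telescoping is x / c; the factor c keeps x in ℕ.
∑-binomials : ∀ n s t e c d .{{_ : NonZero c}} .{{_ : NonZero d}} {A B} (p x : ℕ → ℕ) →
  suc (s + n) ≡ A → suc (t + (n + e)) ≡ B →
  (∀ k m → k + m ≡ n →
    c * p k + x (suc k) * (m * (m + e)) ≡ x k * (suc (s + k) * suc (t + k))) →
  ∑[ k ≤ n ] ((+ p k / d) ℚ.* fromℕ (A C (n ∸ k)) ℚ.* fromℕ (B C ((n ∸ k) + e)))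
    ≡ (+ (A * B * x 0 * ((s + n) C s) * ((t + (n + e)) C t)) / (c * d)) {{m*n≢0 c d}}
∑-binomials n s t e c d p x refl refl cert = trans
  (∑-telescope n f T step end)
  (cong₂ (λ i j → + (suc M * suc N * x 0 * (M C i) * (N C j)) / (c * d))
    (+-identityʳ s) (+-identityʳ t))
  where
  M = s + n
  N = t + (n + e)
  instance
    cd≢0 : NonZero (c * d)
    cd≢0 = m*n≢0 c d
  f T : ℕ → ℚ.ℚ
  f k = (+ p k / d) ℚ.* fromℕ (suc M C (n ∸ k)) ℚ.* fromℕ (suc N C ((n ∸ k) + e))
  T k = + (suc M * suc N * x k * (M C (s + k)) * (N C (t + k))) / (c * d)
  end : T (suc n) ≡ ℚ.0ℚ
  end = trans (cong (λ z → + z / (c * d)) (trans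
      (cong (λ z → suc M * suc N * x (suc n) * z * (N C (t + suc n)))
        (trans (cong (M C_) (+-suc s n)) (k>n⇒nCk≡0 (n<1+n M))))
      (cong (_* (N C (t + suc n))) (ℕₚ.*-zeroʳ (suc M * suc N * x (suc n))))))
    (0/n≡0 (c * d))
  step : ∀ k m → k + m ≡ n → f k ℚ.+ T (suc k) ≡ T k
  step k m eq = begin
    f k ℚ.+ T (suc k)
      ≡⟨ cong (ℚ._+ T (suc k)) (cong₂ (λ y z → (+ p k / d) ℚ.* fromℕ y ℚ.* fromℕ z) P≡ Q≡) ⟩
    (+ p k / d) ℚ.* fromℕ P ℚ.* fromℕ Q ℚ.+ T (suc k)
      ≡⟨ cong (ℚ._+ T (suc k)) (trans (cong (ℚ._* fromℕ Q) (/-*-fromℕ (p k) d P))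
           (/-*-fromℕ (p k * P) d Q)) ⟩
    (+ (p k * P * Q) / d) ℚ.+ T (suc k)
      -- Expanding the fraction by `c` gives it the denominator of `T`, so the numerators can be
      -- added.
      ≡⟨ cong (ℚ._+ T (suc k)) (/-cross (p k * P * Q) d (c * p k * P * Q) (c * d)
           (scale c d (p k) P Q)) ⟩
    (+ (c * p k * P * Q) / (c * d)) ℚ.+ T (suc k)
      ≡⟨ /-+-/ (c * p k * P * Q) _ (c * d) ⟩
    + (c * p k * P * Q + suc M * suc N * x (suc k) * (M C (s + suc k)) * (N C (t + suc k))) / (c * d)
      ≡⟨ cong (λ z → + z / (c * d)) (trans
           (cong₂ (λ i j → c * p k * P * Q + suc M * suc N * x (suc k) * (M C i) * (N C j))
             (+-suc s k) (+-suc t k))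
           (C-telescope {M} {N} {s + k} {t + k} {m} {m + e} {c * p k} {x k} {x (suc k)}
             M≡ N≡ (cert k m eq))) ⟩
    T k ∎
    where
    P = suc M C suc (s + k)
    Q = suc N C suc (t + k)
    scale : ∀ c d p P Q → p * P * Q * (c * d) ≡ c * p * P * Q * d
    scale = solve-∀
    M≡ : s + k + m ≡ M
    M≡ = trans (ℕₚ.+-assoc s k m) (cong (_+_ s) eq)
    shift : ∀ t k m e → t + k + (m + e) ≡ t + (k + m + e)
    shift = solve-∀
    N≡ : t + k + (m + e) ≡ N
    N≡ = trans (shift t k m e) (cong (λ z → t + (z + e)) eq)
    n∸k≡m : n ∸ k ≡ m
    n∸k≡m = trans (cong (_∸ k) (sym eq)) (m+n∸m≡n k m)
    -- By symmetry the lower index, which falls with `k`, becomes one that rises with `k`, as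
    -- `C-telescope` needs.
    P≡ : suc M C (n ∸ k) ≡ P
    P≡ = trans (cong (suc M C_) n∸k≡m) (sym (C-sym (suc (s + k)) m (cong suc M≡)))
    Q≡ : suc N C ((n ∸ k) + e) ≡ Q
    Q≡ = trans (cong (λ z → suc N C (z + e)) n∸k≡m) (sym (C-sym (suc (t + k)) (m + e) (cong suc N≡)))

-- Central binomial coefficients and products of Catalan numbers.

central : ℕ → ℕ
central n = (2 * n) C n

catalan-product : ∀ m n T d .{{_ : NonZero d}} →
  d * (central m * central n) ≡ T * (suc m * suc n) → catalan m ℚ.* catalan n ≡ + T / d
catalan-product m n T d eq = begin
  catalan m ℚ.* catalan n
    ≡⟨ cong₂ ℚ._*_ (catalan-/ m) (catalan-/ n) ⟩
  (+ central m / suc m) ℚ.* (+ central n / suc n)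
    ≡⟨ /-*-/ (central m) (suc m) (central n) (suc n) ⟩
  + (central m * central n) / (suc m * suc n)
    ≡⟨ /-cross (central m * central n) (suc m * suc n) T d (trans (ℕₚ.*-comm _ d) eq) ⟩
  + T / d ∎
  where
  catalan-/ : ∀ n → catalan n ≡ + central n / suc n
  catalan-/ n = trans (/-*-fromℕ 1 (suc n) (central n))
    (cong (λ z → + z / suc n) (*-identityˡ (central n)))

-- The two middle entries of an odd row are equal, and by Pascal's rule their sum is the central
-- entry of the next row.
central-half : ∀ n {M} → suc (2 * n) ≡ M → 2 * (M C suc n) ≡ central (suc n)
central-half n refl = begin
  2 * (suc (2 * n) C suc n)
    ≡⟨ cong (_+_ (suc (2 * n) C suc n)) (+-identityʳ _) ⟩
  (suc (2 * n) C suc n) + (suc (2 * n) C suc n)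
    ≡⟨ cong (_+ (suc (2 * n) C suc n)) (C-sym (suc n) n (double n)) ⟩
  (suc (2 * n) C n) + (suc (2 * n) C suc n)
    ≡⟨ nCk+nC[k+1]≡[n+1]C[k+1] (suc (2 * n)) n ⟩
  suc (suc (2 * n)) C suc n
    ≡⟨ cong (_C suc n) (double′ n) ⟩
  central (suc n) ∎
  where
  double : ∀ n → suc n + n ≡ suc (2 * n)
  double = solve-∀
  double′ : ∀ n → suc (suc (2 * n)) ≡ 2 * suc n
  double′ = solve-∀

-- `central-half` leads from row `2n + 2` to row `2n + 1`, and absorption from there to row `2n`.
central-suc : ∀ n → suc n * central (suc n) ≡ 2 * suc (2 * n) * central n
central-suc n = begin
  suc n * central (suc n)
    ≡⟨ cong (suc n *_) (central-half n refl) ⟨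
  suc n * (2 * (suc (2 * n) C suc n))
    ≡⟨ swap (suc n) (suc (2 * n) C suc n) ⟩
  2 * ((suc (2 * n) C suc n) * suc n)
    ≡⟨ cong (2 *_) (C-absorb (2 * n) n n (cong (_+_ n) (sym (+-identityʳ n)))) ⟩
  2 * (central n * suc (2 * n))
    ≡⟨ swap′ (central n) (suc (2 * n)) ⟩
  2 * suc (2 * n) * central n ∎
  where
  swap : ∀ a b → a * (2 * b) ≡ 2 * (b * a)
  swap = solve-∀
  swap′ : ∀ a b → 2 * (a * b) ≡ 2 * b * a
  swap′ = solve-∀

-- The entry just right of the centre: `C-ratio` with `u` and `a` both equal to `n`.
central-next : ∀ n {M} → 2 * n ≡ M → suc n * (M C suc n) ≡ n * central n
central-next n refl = trans (ℕₚ.*-comm (suc n) _)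
  (trans (C-ratio (2 * n) n n (cong (_+_ n) (sym (+-identityʳ n)))) (ℕₚ.*-comm (central n) n))

-- Leaves two checks in ℕ for each identity: the certificate equation, which makes the sum
-- telescope, and the agreement of its value `T 0` with the Catalan product.
catalan-product-sum : ∀ i j n s t e c d .{{_ : NonZero c}} .{{_ : NonZero d}} {A B} (p x : ℕ → ℕ) →
  suc (s + n) ≡ A → suc (t + (n + e)) ≡ B →
  (∀ k m → k + m ≡ n →
    c * p k + x (suc k) * (m * (m + e)) ≡ x k * (suc (s + k) * suc (t + k))) →
  c * d * (central i * central j)
    ≡ A * B * x 0 * ((s + n) C s) * ((t + (n + e)) C t) * (suc i * suc j) →
  catalan i ℚ.* catalan j
    ≡ ∑[ k ≤ n ] ((+ p k / d) ℚ.* fromℕ (A C (n ∸ k)) ℚ.* fromℕ (B C ((n ∸ k) + e)))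
catalan-product-sum i j n s t e c d {A} {B} p x A≡ B≡ cert eq = trans
  (catalan-product i j (A * B * x 0 * ((s + n) C s) * ((t + (n + e)) C t)) (c * d) {{m*n≢0 c d}} eq)
  (sym (∑-binomials n s t e c d p x A≡ B≡ cert))

-- The three identities: certificates and closed forms.

-- The denominator is a variable d, here and below, so that it is never unfolded as a
-- product of successors.
catalan²-sum : ∀ n d .{{_ : NonZero d}} →
  d ≡ (1 + 2 * n) * (2 + 2 * n) * (3 + 2 * n) * (4 + 2 * n) * (5 + 2 * n) →
  catalan (suc n) ℚ.* catalan (suc n)
  ≡ ∑[ k ≤ n ]
      (+ ((2 * k + 1) * (2 * k + 3) * (8 * n * k + 2 * n + 10 * k + 4)) / d)
      ℚ.* fromℕ ((2 * n + 2) C (n ∸ k))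
      ℚ.* fromℕ ((2 * n + 5) C ((n ∸ k) + 2))
catalan²-sum n d d≡ =
  catalan-product-sum (suc n) (suc n) n (1 + n) (2 + n) 2 1 d p x (A≡ n) (B≡ n) cert closed
  where
  p x : ℕ → ℕ
  p k = (2 * k + 1) * (2 * k + 3) * (8 * n * k + 2 * n + 10 * k + 4)
  -- In the certificate equation the quartic terms in `k` cancel, so the cubic `p` calls for a
  -- quadratic `x`. If `a` is its leading coefficient, the cubic terms give
  -- `a (4n + 5) = 4 (8n + 10)`, hence `a = 8`.
  x k = 8 * k * k + 4 * k + 4 * n + 2
  A≡ : ∀ n → suc (1 + n + n) ≡ 2 * n + 2
  A≡ = solve-∀
  B≡ : ∀ n → suc (2 + n + (n + 2)) ≡ 2 * n + 5
  B≡ = solve-∀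
  -- With `n` written as `k + m` no subtraction occurs, and the certificate is a semiring identity.
  poly : ∀ k m →
    1 * ((2 * k + 1) * (2 * k + 3) * (8 * (k + m) * k + 2 * (k + m) + 10 * k + 4))
      + (8 * suc k * suc k + 4 * suc k + 4 * (k + m) + 2) * (m * (m + 2))
    ≡ (8 * k * k + 4 * k + 4 * (k + m) + 2) * (suc (1 + (k + m) + k) * suc (2 + (k + m) + k))
  poly = solve-∀
  cert : ∀ k m → k + m ≡ n →
    1 * p k + x (suc k) * (m * (m + 2)) ≡ x k * (suc (1 + n + k) * suc (2 + n + k))
  cert k m refl = poly k m
  b₁ = central (1 + n)
  b₂ = central (2 + n)
  h = (1 + n + n) C (1 + n)
  expand : ∀ n b₁ →
    1 * ((1 + 2 * n) * (2 + 2 * n) * (3 + 2 * n) * (4 + 2 * n) * (5 + 2 * n)) * (b₁ * b₁)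
      ≡ (2 + 2 * n) * (5 + 2 * n) * (1 + 2 * n) * (2 + n) * b₁ * (2 * suc (2 * suc n) * b₁)
  expand = solve-∀
  collect : ∀ n h b₂ →
    (2 + 2 * n) * (5 + 2 * n) * (1 + 2 * n) * (2 + n) * (2 * h) * (suc (suc n) * b₂)
      ≡ (2 * n + 2) * (2 * n + 5) * (4 * n + 2) * h * b₂ * (suc (suc n) * suc (suc n))
  collect = solve-∀
  M≡ : ∀ n → suc (2 * n) ≡ 1 + n + n
  M≡ = solve-∀
  N≡ : ∀ n → 2 * (2 + n) ≡ 2 + n + (n + 2)
  N≡ = solve-∀
  closed : 1 * d * (b₁ * b₁)
    ≡ (2 * n + 2) * (2 * n + 5) * x 0 * h * ((2 + n + (n + 2)) C (2 + n))
        * (suc (suc n) * suc (suc n))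
  closed = begin
    1 * d * (b₁ * b₁)
      ≡⟨ cong (λ z → 1 * z * (b₁ * b₁)) d≡ ⟩
    _ ≡⟨ expand n b₁ ⟩
    (2 + 2 * n) * (5 + 2 * n) * (1 + 2 * n) * (2 + n) * b₁ * (2 * suc (2 * suc n) * b₁)
      -- One `b₁` becomes `2h`; the other, with its factor `2 (2n + 3)`, becomes `(n + 2) b₂`. The
      -- remaining `2 (2n + 1)` is `x 0`.
      ≡⟨ cong₂ (λ y z → (2 + 2 * n) * (5 + 2 * n) * (1 + 2 * n) * (2 + n) * y * z)
           (sym (central-half n (M≡ n))) (sym (central-suc (suc n))) ⟩
    (2 + 2 * n) * (5 + 2 * n) * (1 + 2 * n) * (2 + n) * (2 * h) * (suc (suc n) * b₂)
      ≡⟨ collect n h b₂ ⟩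
    (2 * n + 2) * (2 * n + 5) * (4 * n + 2) * h * b₂ * (suc (suc n) * suc (suc n))
      ≡⟨ cong (λ z → (2 * n + 2) * (2 * n + 5) * (4 * n + 2) * h * (z C (2 + n))
           * (suc (suc n) * suc (suc n))) (N≡ n) ⟩
    _ ∎

catalan-catalan₁-sum : ∀ n d .{{_ : NonZero d}} →
  d ≡ (1 + 2 * n) * (2 + 2 * n) * (3 + 2 * n) ^ 2 →
  catalan n ℚ.* catalan (suc n)
  ≡ ∑[ k ≤ n ]
      (+ ((2 * k + 1) * (2 * k + 2) * (2 * k + 3)) / d)
      ℚ.* fromℕ ((2 * n + 3) C (n ∸ k))
      ℚ.* fromℕ ((2 * n + 3) C ((n ∸ k) + 1))
catalan-catalan₁-sum n d d≡ =
  catalan-product-sum n (suc n) n (2 + n) (1 + n) 1 (suc n) d p x (A≡ n) (B≡ n) cert closed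
  where
  p x : ℕ → ℕ
  p k = (2 * k + 1) * (2 * k + 2) * (2 * k + 3)
  -- The cubic terms now give `a (4n + 4) = 8c` for the leading coefficient `a`, so `c = n + 1`
  -- clears the denominator and `a = 2`.
  x k = 2 * k * k + 2 * k + n + 1
  A≡ : ∀ n → suc (2 + n + n) ≡ 2 * n + 3
  A≡ = solve-∀
  B≡ : ∀ n → suc (1 + n + (n + 1)) ≡ 2 * n + 3
  B≡ = solve-∀
  poly : ∀ k m →
    suc (k + m) * ((2 * k + 1) * (2 * k + 2) * (2 * k + 3))
      + (2 * suc k * suc k + 2 * suc k + (k + m) + 1) * (m * (m + 1))
    ≡ (2 * k * k + 2 * k + (k + m) + 1) * (suc (2 + (k + m) + k) * suc (1 + (k + m) + k))
  poly = solve-∀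
  cert : ∀ k m → k + m ≡ n →
    suc n * p k + x (suc k) * (m * (m + 1)) ≡ x k * (suc (2 + n + k) * suc (1 + n + k))
  cert k m refl = poly k m
  b₀ = central n
  b₁ = central (1 + n)
  r = (2 + n + n) C (2 + n)
  expand : ∀ n b₀ b₁ →
    suc n * ((1 + 2 * n) * (2 + 2 * n) * ((3 + 2 * n) * ((3 + 2 * n) * 1))) * (b₀ * b₁)
      ≡ (2 * n + 3) * (2 * n + 3) * (n + 1) * (n + 1) * b₁ * (2 * suc (2 * n) * b₀)
  expand = solve-∀
  collect : ∀ n r b₁ →
    (2 * n + 3) * (2 * n + 3) * (n + 1) * (n + 1) * b₁ * (suc (suc n) * r)
      ≡ (2 * n + 3) * (2 * n + 3) * (n + 1) * r * b₁ * (suc n * suc (suc n))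
  collect = solve-∀
  M≡ : ∀ n → 2 * suc n ≡ 2 + n + n
  M≡ = solve-∀
  N≡ : ∀ n → 2 * suc n ≡ 1 + n + (n + 1)
  N≡ = solve-∀
  closed : suc n * d * (b₀ * b₁)
    ≡ (2 * n + 3) * (2 * n + 3) * x 0 * r * ((1 + n + (n + 1)) C (1 + n)) * (suc n * suc (suc n))
  closed = begin
    suc n * d * (b₀ * b₁)
      ≡⟨ cong (λ z → suc n * z * (b₀ * b₁)) d≡ ⟩
    _ ≡⟨ expand n b₀ b₁ ⟩
    (2 * n + 3) * (2 * n + 3) * (n + 1) * (n + 1) * b₁ * (2 * suc (2 * n) * b₀)
      -- `2 (2n + 1) b₀ = (n + 1) b₁ = (n + 2) r`, where `r` is next to the centre of row `2n + 2`.
      ≡⟨ cong ((2 * n + 3) * (2 * n + 3) * (n + 1) * (n + 1) * b₁ *_)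
           (trans (sym (central-suc n)) (sym (central-next (suc n) (M≡ n)))) ⟩
    (2 * n + 3) * (2 * n + 3) * (n + 1) * (n + 1) * b₁ * (suc (suc n) * r)
      ≡⟨ collect n r b₁ ⟩
    (2 * n + 3) * (2 * n + 3) * (n + 1) * r * b₁ * (suc n * suc (suc n))
      ≡⟨ cong (λ z → (2 * n + 3) * (2 * n + 3) * (n + 1) * r * (z C (1 + n))
           * (suc n * suc (suc n))) (N≡ n) ⟩
    _ ∎

catalan-catalan₂-sum : ∀ n d .{{_ : NonZero d}} →
  d ≡ (1 + 2 * n) * (2 + 2 * n) * (3 + 2 * n) * (4 + 2 * n) * (5 + 2 * n) →
  catalan n ℚ.* catalan (suc (suc n))
  ≡ ∑[ k ≤ n ]
      (+ ((2 * k + 1) * (2 * k + 3) * (8 * n * k + 14 * n + 10 * k + 16)) / d)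
      ℚ.* fromℕ ((2 * n + 2) C (n ∸ k))
      ℚ.* fromℕ ((2 * n + 5) C ((n ∸ k) + 1))
catalan-catalan₂-sum n d d≡ =
  catalan-product-sum n (suc (suc n)) n (1 + n) (3 + n) 1 1 d p x (A≡ n) (B≡ n) cert closed
  where
  p x : ℕ → ℕ
  p k = (2 * k + 1) * (2 * k + 3) * (8 * n * k + 14 * n + 10 * k + 16)
  -- Again `a (4n + 5) = 4 (8n + 10)`, so the leading coefficient is 8.
  x k = 8 * k * k + 12 * k + 4 * n + 6
  A≡ : ∀ n → suc (1 + n + n) ≡ 2 * n + 2
  A≡ = solve-∀
  B≡ : ∀ n → suc (3 + n + (n + 1)) ≡ 2 * n + 5
  B≡ = solve-∀
  poly : ∀ k m →
    1 * ((2 * k + 1) * (2 * k + 3) * (8 * (k + m) * k + 14 * (k + m) + 10 * k + 16))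
      + (8 * suc k * suc k + 12 * suc k + 4 * (k + m) + 6) * (m * (m + 1))
    ≡ (8 * k * k + 12 * k + 4 * (k + m) + 6) * (suc (1 + (k + m) + k) * suc (3 + (k + m) + k))
  poly = solve-∀
  cert : ∀ k m → k + m ≡ n →
    1 * p k + x (suc k) * (m * (m + 1)) ≡ x k * (suc (1 + n + k) * suc (3 + n + k))
  cert k m refl = poly k m
  b₀ = central n
  b₁ = central (1 + n)
  b₂ = central (2 + n)
  h = (1 + n + n) C (1 + n)
  r = (3 + n + (n + 1)) C (3 + n)
  expand : ∀ n b₀ b₂ →
    1 * ((1 + 2 * n) * (2 + 2 * n) * (3 + 2 * n) * (4 + 2 * n) * (5 + 2 * n)) * (b₀ * b₂)
      ≡ (3 + 2 * n) * (2 + 2 * n) * (5 + 2 * n) * (2 * suc (2 * n) * b₀) * ((2 + n) * b₂)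
  expand = solve-∀
  collect : ∀ n h r →
    (3 + 2 * n) * (2 + 2 * n) * (5 + 2 * n) * (suc n * (2 * h)) * (suc (2 + n) * r)
      ≡ (2 * n + 2) * (2 * n + 5) * (4 * n + 6) * h * r * (suc n * suc (suc (suc n)))
  collect = solve-∀
  M≡ : ∀ n → suc (2 * n) ≡ 1 + n + n
  M≡ = solve-∀
  N≡ : ∀ n → 2 * (2 + n) ≡ 3 + n + (n + 1)
  N≡ = solve-∀
  closed : 1 * d * (b₀ * b₂)
    ≡ (2 * n + 2) * (2 * n + 5) * x 0 * h * r * (suc n * suc (suc (suc n)))
  closed = begin
    1 * d * (b₀ * b₂)
      ≡⟨ cong (λ z → 1 * z * (b₀ * b₂)) d≡ ⟩
    _ ≡⟨ expand n b₀ b₂ ⟩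
    (3 + 2 * n) * (2 + 2 * n) * (5 + 2 * n) * (2 * suc (2 * n) * b₀) * ((2 + n) * b₂)
      -- `b₀` passes through `(n + 1) b₁` to `2 (n + 1) h`, and `(n + 2) b₂` becomes `(n + 3) r`,
      -- with `r` next to the centre of row `2n + 4`.
      ≡⟨ cong₂ (λ y z → (3 + 2 * n) * (2 + 2 * n) * (5 + 2 * n) * y * z)
           (trans (sym (central-suc n)) (cong (suc n *_) (sym (central-half n (M≡ n)))))
           (sym (central-next (2 + n) (N≡ n))) ⟩
    (3 + 2 * n) * (2 + 2 * n) * (5 + 2 * n) * (suc n * (2 * h)) * (suc (2 + n) * r)
      ≡⟨ collect n h r ⟩
    _ ∎

corollary3p4 : (n : ℕ) →
    (catalan (n + 1) ℚ.* catalan (n + 1)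
    ≡ ∑[ k ≤ n ]
    (+ ((2 * k + 1) * (2 * k + 3) * (8 * n * k + 2 * n + 10 * k + 4))
    / ((1 + 2 * n) * (2 + 2 * n) * (3 + 2 * n) * (4 + 2 * n) * (5 + 2 * n)))
    ℚ.* fromℕ ((2 * n + 2) C (n ∸ k))
    ℚ.* fromℕ ((2 * n + 5) C ((n ∸ k) + 2)))
    × (catalan n ℚ.* catalan (n + 1)
    ≡ ∑[ k ≤ n ]
    (+ ((2 * k + 1) * (2 * k + 2) * (2 * k + 3))
    / ((1 + 2 * n) * (2 + 2 * n) * (3 + 2 * n) ^ 2))
    ℚ.* fromℕ ((2 * n + 3) C (n ∸ k))
    ℚ.* fromℕ ((2 * n + 3) C ((n ∸ k) + 1)))
    × (catalan n ℚ.* catalan (n + 2)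
    ≡ ∑[ k ≤ n ]
    (+ ((2 * k + 1) * (2 * k + 3) * (8 * n * k + 14 * n + 10 * k + 16))
    / ((1 + 2 * n) * (2 + 2 * n) * (3 + 2 * n) * (4 + 2 * n) * (5 + 2 * n)))
    ℚ.* fromℕ ((2 * n + 2) C (n ∸ k))
    ℚ.* fromℕ ((2 * n + 5) C ((n ∸ k) + 1)))
corollary3p4 n =
    trans (cong (λ i → catalan i ℚ.* catalan i) (+-comm n 1)) (catalan²-sum n _ refl)
  , trans (cong (λ i → catalan n ℚ.* catalan i) (+-comm n 1)) (catalan-catalan₁-sum n _ refl)
  , trans (cong (λ i → catalan n ℚ.* catalan i) (+-comm n 2)) (catalan-catalan₂-sum n _ refl)
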